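{- Let $\pi$ be an ASP program and let $\lambda \subseteq \pi$ be a sub-program that is compilable with respect to $\pi$. Then for every answer set $M_\pi$ of $\pi$ there exists an answer set $M_{\pi\setminus\lambda}$ of the program $\pi\setminus\lambda$ such that $M_\pi$ is the unique answer set of the program $\{\, f. \mid f \in M^+_{\pi\setminus\lambda}\,\} \cup \lambda$ (i.e., $\lambda$ together with every positive atom of $M_{\pi\setminus\lambda}$ added as a fact).
   Context: An ASP program is a finite set of rules $h_1 \mid \dots \mid h_n \text{ :- } b_1,\dots,b_m.$ with $n,m\ge 0$, $n+m\neq 0$, where the $h_i$ (the head) are atoms $p(t_1,\dots,t_k)$ with terms being variables or constants, and the $b_j$ (the body) are literals, i.e. atoms $a$ or their default negations $\sim a$. The positive body $body^+_r$ consists of the atoms in the body of $r$, the negative body $body^-_r$ of the negated atoms; a rule with $n=0$ is a constraint, and a rule with $n=1$, $m=0$ is a fact. A sub-program of $\pi$ is any subset of its rules. For a program $\pi$, $U_\pi$ is the set of constants in $\pi$, $B_\pi$ the set of ground atoms built from predicates of $\pi$ and constants of $U_\pi$, and $\mathit{Ground}(\pi)$ is the set of all ground instances of rules of $\pi$ obtained by substituting variables with elements of $U_\pi$. An interpretation $I$ is a consistent set of literals containing, for every $a\in B_\pi$, either $a$ or $\sim a$; $I^+$ denotes its positive literals. $I$ is a model of $\pi$ if for every $r\in \mathit{Ground}(\pi)$ whose body literals are all true in $I$ (i.e. belong to $I$), some head atom of $r$ is true in $I$. The reduct $\pi^I$ of $\mathit{Ground}(\pi)$ w.r.t. $I$ is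 obtained by deleting rules whose negative body is false w.r.t. $I$ and deleting the negative body from the remaining rules. $I$ is an answer set (stable model) of $\pi$ if $I$ is a model of $\pi$ and there is no model $J$ of $\pi^I$ with $J^+\subsetneq I^+$. The dependency graph $DG_\pi$ of $\pi$ has as vertices the predicate names appearing in some rule head of $\pi$, and labeled edges: $(p,q,+)$ if some rule has $p$ in its positive body and $q$ in its head; $(p,q,-)$ if some rule has $p$ in its negative body and $q$ in its head; $(p,q,-)$ if some rule has both $p$ and $q$ in its head. $\pi$ is stratified if $DG_\pi$ has no cycle containing a negative edge. A sub-program $\lambda\subseteq\pi$ is compilable with respect to $\pi$ if (i) $\lambda$ is stratified, and (ii) no predicate name occurring in a head atom of a rule of $\lambda$ occurs anywhere in $\pi\setminus\lambda$.
   Formalization: Rules are assumed safe (every variable occurs in the positive body), without which the claim fails; "M_π is the unique answer set" compares positive literals only, since the bases may differ; head-head negative edges come from two different head atoms. -}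

module Defs where

open import Data.List using (List; []; _∷_; _++_; map; mapMaybe; concatMap; filter; length)
open import Data.List.Membership.Propositional using (_∈_; _∉_)
open import Data.List.Relation.Binary.Subset.Propositional using (_⊆_)
open import Data.List.Relation.Unary.All using (All)
open import Data.List.Relation.Unary.Any using (Any)
open import Data.Maybe using (Maybe; just; nothing)
open import Data.Nat using (ℕ; _+_)
open import Data.Product using (∃-syntax; _×_; _,_)
open import Data.Sum using (_⊎_)
open import Data.Vec using (Vec)
open import Function using (_∘_)
open import Relation.Binary using (DecidableEquality)
open import Relation.Binary.PropositionalEquality using (_≡_; _≢_; refl; cong)
open import Relation.Nullary using (¬_; yes; no)
open import Relation.Nullary.Decidable using (¬?)
import Data.List.Membership.DecPropositional as DecMembership
import Data.List.Properties as Listₚ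
import Data.Nat as Nat
import Data.Vec as Vec
import Data.Vec.Properties as Vecₚ
import Data.Vec.Relation.Unary.All as VecAll

-- Names are drawn from countably infinite supplies.

Variable Constant Predicate : Set
Variable  = ℕ
Constant  = ℕ
Predicate = ℕ

data Term : Set where
  var : Variable → Term
  con : Constant → Term

data Sign : Set where
  positive negative : Sign

_≟ᵗ_ : DecidableEquality Term
var x ≟ᵗ var y with x Nat.≟ y
... | yes refl = yes refl
... | no x≢y   = no λ { refl → x≢y refl }
var _ ≟ᵗ con _ = no λ ()
con _ ≟ᵗ var _ = no λ ()
con c ≟ᵗ con d with c Nat.≟ d
... | yes refl = yes refl
... | no c≢d   = no λ { refl → c≢d refl }

varsᵗ : Term → List Variable
varsᵗ (var x) = x ∷ []
varsᵗ (con _) = []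

consᵗ : Term → List Constant
consᵗ (var _) = []
consᵗ (con c) = c ∷ []

substᵗ : (Variable → Constant) → Term → Constant
substᵗ σ (var x) = σ x
substᵗ σ (con c) = c

module ASP (arity : Predicate → ℕ) where

  -- T = Term gives general expressions, T = Constant ground ones.

  record Atom (T : Set) : Set where
    constructor atom
    field
      pred : Predicate
      args : Vec T (arity pred)

  open Atom public

  data Literal (T : Set) : Set where
    pos : Atom T → Literal T
    ∼_  : Atom T → Literal T

  record Rule (T : Set) : Set where
    constructor _:-_
    field
      head : List (Atom T)
      body : List (Literal T)

  open Rule public

  -- A list stands for the finite set of its members: order and
  -- multiplicity of rules are never observed.

  Program : Set
  Program = List (Rule Term)

  mapAtom : {S T : Set} → (S → T) → Atom S → Atom T
  mapAtom f (atom p ts) = atom p (Vec.map f ts)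

  mapLiteral : {S T : Set} → (S → T) → Literal S → Literal T
  mapLiteral f (pos a) = pos (mapAtom f a)
  mapLiteral f (∼ a)   = ∼ mapAtom f a

  mapRule : {S T : Set} → (S → T) → Rule S → Rule T
  mapRule f (hs :- bs) = map (mapAtom f) hs :- map (mapLiteral f) bs

  posAtom negAtom : {T : Set} → Literal T → Maybe (Atom T)
  posAtom (pos a) = just a
  posAtom (∼ _)   = nothing
  negAtom (pos _) = nothing
  negAtom (∼ a)   = just a

  atomOf : {T : Set} → Literal T → Atom T
  atomOf (pos a) = a
  atomOf (∼ a)   = a

  infix 8 _⁺ _⁻

  _⁺ _⁻ : {T : Set} → List (Literal T) → List (Atom T)
  _⁺ = mapMaybe posAtom
  _⁻ = mapMaybe negAtom

  body⁺ body⁻ : {T : Set} → Rule T → List (Atom T)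
  body⁺ r = body r ⁺
  body⁻ r = body r ⁻

  atoms : {T : Set} → Rule T → List (Atom T)
  atoms r = head r ++ map atomOf (body r)

  termsᵃ : {T : Set} → List (Atom T) → List T
  termsᵃ = concatMap (Vec.toList ∘ args)

  vars : List (Atom Term) → List Variable
  vars = concatMap varsᵗ ∘ termsᵃ

  headPreds preds : Program → List Predicate
  headPreds = concatMap (map pred ∘ head)
  preds     = concatMap (map pred ∘ atoms)

  -- The condition n + m ≠ 0 on rules.  It is a predicate on rules, not a
  -- field of Rule, because taking the reduct may produce an empty rule.

  NonEmpty : Rule Term → Set
  NonEmpty r = length (head r) + length (body r) ≢ 0

  -- The usual safety condition.  It cannot be dropped from the theorem:
  -- each program is grounded over its own constants, so for
  --   π = { p(c).   a :- ∼ p(X).   q(d). }   and   λ = { q(d). }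
  -- the atom a holds in the answer set of π (take X = d), but not in that
  -- of π ∖ λ, whose only constant is c.

  Safe : Rule Term → Set
  Safe r = vars (atoms r) ⊆ vars (body⁺ r)

  _≟ᵃ_ : DecidableEquality (Atom Term)
  atom p ts ≟ᵃ atom q us with p Nat.≟ q
  ... | no p≢q = no λ e → p≢q (cong pred e)
  ... | yes refl with Vecₚ.≡-dec _≟ᵗ_ ts us
  ...   | yes refl  = yes refl
  ...   | no ts≢us = no λ { refl → ts≢us refl }

  _≟ˡ_ : DecidableEquality (Literal Term)
  pos a ≟ˡ pos b with a ≟ᵃ b
  ... | yes refl = yes refl
  ... | no a≢b   = no λ { refl → a≢b refl }
  pos _ ≟ˡ (∼ _) = no λ ()
  (∼ _) ≟ˡ pos _ = no λ ()
  (∼ a) ≟ˡ (∼ b) with a ≟ᵃ b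
  ... | yes refl = yes refl
  ... | no a≢b   = no λ { refl → a≢b refl }

  _≟ʳ_ : DecidableEquality (Rule Term)
  (hs :- bs) ≟ʳ (hs′ :- bs′) with Listₚ.≡-dec _≟ᵃ_ hs hs′ | Listₚ.≡-dec _≟ˡ_ bs bs′
  ... | yes refl | yes refl  = yes refl
  ... | no hs≢   | _         = no λ { refl → hs≢ refl }
  ... | yes _    | no bs≢    = no λ { refl → bs≢ refl }

  open DecMembership _≟ʳ_ using (_∈?_)

  infixl 6 _∖_

  _∖_ : Program → Program → Program
  π ∖ ρ = filter (λ r → ¬? (r ∈? ρ)) π

  U : Program → List Constant
  U = concatMap (concatMap consᵗ ∘ termsᵃ ∘ atoms)

  B : Program → Atom Constant → Set
  B π a = pred a ∈ preds π × VecAll.All (_∈ U π) (args a)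

  GroundProgram : Set₁
  GroundProgram = Rule Constant → Set

  -- Only the values of σ on the variables of r matter.

  Ground : Program → GroundProgram
  Ground π g =
    ∃[ r ] ∃[ σ ] r ∈ π
                × (∀ {x} → x ∈ vars (atoms r) → σ x ∈ U π)
                × g ≡ mapRule (substᵗ σ) r

  -- B π is finite, so interpretations are finite sets of ground literals.

  LiteralSet : Set
  LiteralSet = List (Literal Constant)

  record IsInterpretation (π : Program) (I : LiteralSet) : Set where
    field
      consistent : ∀ a → ¬ (pos a ∈ I × (∼ a) ∈ I)
      total      : ∀ a → B π a → pos a ∈ I ⊎ (∼ a) ∈ I
      overBase   : ∀ l → l ∈ I → B π (atomOf l)

  Satisfies : LiteralSet → GroundProgram → Set
  Satisfies I G =
    ∀ r → G r → All (_∈ I) (body r) → Any (λ h → pos h ∈ I) (head r)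

  Reduct : GroundProgram → LiteralSet → GroundProgram
  Reduct G I g =
    ∃[ r ] G r
         × All (λ a → (∼ a) ∈ I) (body⁻ r)
         × g ≡ (head r :- map pos (body⁺ r))

  infix 4 _⊊_ _≈⁺_

  _⊊_ : List (Atom Constant) → List (Atom Constant) → Set
  xs ⊊ ys = xs ⊆ ys × ¬ (ys ⊆ xs)

  record IsAnswerSet (π : Program) (I : LiteralSet) : Set where
    field
      interpretation : IsInterpretation π I
      model          : Satisfies I (Ground π)
      minimal        : ¬ (∃[ J ] IsInterpretation π J
                               × Satisfies J (Reduct (Ground π) I)
                               × J ⁺ ⊊ I ⁺)

  _≈⁺_ : LiteralSet → LiteralSet → Set
  I ≈⁺ J = I ⁺ ⊆ J ⁺ × J ⁺ ⊆ I ⁺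

  -- M may be an interpretation of a program whose base is larger than B π.
  -- It is identified with an answer set of π by its positive literals;
  -- atoms outside B π are false by default.  Two interpretations of the
  -- same program with equal positive parts have the same literals.

  IsUniqueAnswerSet : Program → LiteralSet → Set
  IsUniqueAnswerSet π M =
    (∃[ N ] IsAnswerSet π N × N ≈⁺ M) ×
    (∀ N → IsAnswerSet π N → N ≈⁺ M)

  fact : Atom Constant → Rule Term
  fact a = (mapAtom con a ∷ []) :- []

  -- In `disjunctive` the two predicates come from two different head atoms:
  -- p(a) | p(b) yields a negative loop on p, whereas a rule with a single
  -- head atom yields no such edge.

  data Edge (π : Program) (p q : Predicate) : Sign → Set where
    positiveBody : ∀ {r} → r ∈ π → p ∈ headPreds π →
                   p ∈ map pred (body⁺ r) → q ∈ map pred (head r) →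
                   Edge π p q positive
    negativeBody : ∀ {r} → r ∈ π → p ∈ headPreds π →
                   p ∈ map pred (body⁻ r) → q ∈ map pred (head r) →
                   Edge π p q negative
    disjunctive  : ∀ {r h h′} → r ∈ π →
                   h ∈ head r → h′ ∈ head r → h ≢ h′ →
                   p ≡ pred h → q ≡ pred h′ →
                   Edge π p q negative

  data Walk (π : Program) : Predicate → Predicate → List Sign → Set where
    []  : ∀ {p} → Walk π p p []
    _∷_ : ∀ {p q r s ss} → Edge π p q s → Walk π q r ss → Walk π p r (s ∷ ss)

  -- A negative edge lies on a closed walk iff it lies on a simple cycle.

  Stratified : Program → Set
  Stratified π = ∀ {p ss} → Walk π p p ss → negative ∉ ss

  record Compilable (ρ π : Program) : Set where
    field
      stratified : Stratified ρ
      separated  : ∀ {p} → p ∈ headPreds ρ → p ∉ preds (π ∖ ρ)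

{-# OPTIONS --safe #-}
module Submission where

-- By safety every true atom is built from constants that the rules deriving
-- it can reach, so M splits into its part M′ over the base of π ∖ ρ and its
-- part over the head predicates of ρ, and separation lets minimality be
-- tested on the two parts independently.  Uniqueness is stratification: if
-- N₁ and N₂ agree on every predicate that reaches p through a negative edge,
-- then deleting from N₁ the atoms outside N₂ whose predicate reaches p leaves
-- a model of the reduct by N₁, so by minimality nothing is deleted.

open import Defs
open import Data.Empty using (⊥-elim)
open import Data.List using (List; []; _∷_; _++_; concatMap; filter; length; map)
open import Data.List.Membership.Propositional using (_∈_; _∉_; find; lose)
open import Data.List.Membership.Propositional.Properties using (∈-++⁺ˡ; ∈-++⁺ʳ; ∈-++⁻; ∈-concatMap⁺; ∈-concatMap⁻; ∈-filter⁺; ∈-filter⁻; ∈-map⁺; ∈-map⁻)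
open import Data.List.Properties using (filter-notAll)
open import Data.List.Relation.Binary.Subset.Propositional using (_⊆_)
open import Data.List.Relation.Binary.Subset.Propositional.Properties using (concatMap⁺)
open import Data.List.Relation.Unary.All using (All)
open import Data.List.Relation.Unary.Any using (here; there)
open import Data.Nat using (ℕ; suc; _<_; s≤s)
open import Data.Nat.Properties using (≤-trans; ≤-refl)
open import Data.Product using (∃-syntax; _×_; _,_; proj₁; proj₂; swap)
open import Data.Sum using (_⊎_; inj₁; inj₂; [_,_]′) renaming (map₂ to ⊎-map₂)
open import Data.Vec using (Vec; []; _∷_; toList)
open import Data.Vec.Membership.Propositional.Properties using (∈-toList⁻)
open import Function using (_∘_; id)
open import Relation.Binary using (DecidableEquality)
open import Relation.Binary.PropositionalEquality using (_≡_; refl; sym; trans; subst; cong)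
open import Relation.Nullary using (¬_; Dec; yes; no)
open import Relation.Nullary.Decidable using (¬?; _×-dec_; _⊎-dec_; _→-dec_; decidable-stable; toSum; ¬¬-excluded-middle)
open import Relation.Unary using (Decidable)
import Data.List.Membership.DecPropositional as DecMembership
import Data.List.Relation.Unary.All as All
import Data.List.Relation.Unary.All.Properties as Allₚ
import Data.List.Relation.Unary.Any as Any
import Data.List.Relation.Unary.Any.Properties as Anyₚ
import Data.Nat as Nat
import Data.Vec as Vec
import Data.Vec.Properties as Vecₚ
import Data.Vec.Relation.Unary.All as VecAll

open DecMembership Nat._≟_ using () renaming (_∈?_ to _∈ⁿ?_)

-- Membership in lists and vectors.

∈-concatMap⁺′ : {A C : Set} (f : A → List C) {xs : List A} {x : A} {y : C} →
  x ∈ xs → y ∈ f x → y ∈ concatMap f xs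
∈-concatMap⁺′ f x∈xs y∈fx = ∈-concatMap⁺ f (lose x∈xs y∈fx)

∈-concatMap⁻′ : {A C : Set} (f : A → List C) {xs : List A} {y : C} →
  y ∈ concatMap f xs → ∃[ x ] x ∈ xs × y ∈ f x
∈-concatMap⁻′ f y∈ = find (∈-concatMap⁻ f y∈)

concatMap-⊆ : {A C : Set} (f : A → List C) {xs : List A} {zs : List C} →
  (∀ {x} → x ∈ xs → f x ⊆ zs) → concatMap f xs ⊆ zs
concatMap-⊆ f p y∈ = let _ , x∈xs , y∈fx = ∈-concatMap⁻′ f y∈ in p x∈xs y∈fx

allMap⁺ : {A C : Set} {f : A → C} {P : C → Set} {n : ℕ} (ts : Vec A n) →
  (∀ {t} → t ∈ toList ts → P (f t)) → VecAll.All P (Vec.map f ts)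
allMap⁺ []       _ = VecAll.[]
allMap⁺ (t ∷ ts) p = p (here refl) VecAll.∷ allMap⁺ ts (p ∘ there)

allMap⁻ : {A C : Set} {f : A → C} {P : C → Set} {n : ℕ} (ts : Vec A n) →
  VecAll.All P (Vec.map f ts) → ∀ {t} → t ∈ toList ts → P (f t)
allMap⁻ (_ ∷ _)  (p VecAll.∷ _)  (here refl) = p
allMap⁻ (_ ∷ ts) (_ VecAll.∷ ps) (there t∈)  = allMap⁻ ts ps t∈

-- Excluded middle is double-negation provable at each of the finitely many elements. This makes a
-- list out of the predicates reaching a given one without a decision procedure for the existence of
-- walks.
¬¬-sublist : {A : Set} (P : A → Set) (xs : List A) →
  ¬ ¬ (∃[ ys ] (∀ {x} → x ∈ ys → P x) × (∀ {x} → x ∈ xs → P x → x ∈ ys))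
¬¬-sublist P []       k = k ([] , (λ ()) , (λ ()))
¬¬-sublist P (x ∷ xs) k =
  ¬¬-sublist P xs λ (ys , sound , complete) →
  ¬¬-excluded-middle λ where
    (yes px) → k ( x ∷ ys
                 , (λ { (here refl) → px ; (there y∈) → sound y∈ })
                 , (λ { (here refl) _ → here refl ; (there y∈) py → there (complete y∈ py) }))
    (no ¬px) → k ( ys , sound
                 , (λ { (here refl) px → ⊥-elim (¬px px) ; (there y∈) py → complete y∈ py }))

module Answers (arity : Predicate → ℕ) where
  open ASP arity
  open DecMembership _≟ʳ_ using (_∈?_)

  -- Ground literals and Herbrand bases.

  _≟ᵍ_ : DecidableEquality (Atom Constant)
  atom p cs ≟ᵍ atom q ds with p Nat.≟ q
  ... | no p≢q   = no λ e → p≢q (cong pred e)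
  ... | yes refl with Vecₚ.≡-dec Nat._≟_ cs ds
  ...   | yes refl = yes refl
  ...   | no cs≢ds = no λ { refl → cs≢ds refl }

  pos∈⇒∈⁺ : {T : Set} {ls : List (Literal T)} {a : Atom T} → pos a ∈ ls → a ∈ ls ⁺
  pos∈⇒∈⁺ {ls = pos _ ∷ _} (here refl) = here refl
  pos∈⇒∈⁺ {ls = pos _ ∷ _} (there a∈)  = there (pos∈⇒∈⁺ a∈)
  pos∈⇒∈⁺ {ls = (∼ _) ∷ _} (there a∈)  = pos∈⇒∈⁺ a∈

  ∈⁺⇒pos∈ : {T : Set} {ls : List (Literal T)} {a : Atom T} → a ∈ ls ⁺ → pos a ∈ ls
  ∈⁺⇒pos∈ {ls = pos _ ∷ _} (here refl) = here refl
  ∈⁺⇒pos∈ {ls = pos _ ∷ _} (there a∈)  = there (∈⁺⇒pos∈ a∈)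
  ∈⁺⇒pos∈ {ls = (∼ _) ∷ _} a∈          = there (∈⁺⇒pos∈ a∈)

  ∼∈⇒∈⁻ : {T : Set} {ls : List (Literal T)} {a : Atom T} → (∼ a) ∈ ls → a ∈ ls ⁻
  ∼∈⇒∈⁻ {ls = (∼ _) ∷ _} (here refl) = here refl
  ∼∈⇒∈⁻ {ls = (∼ _) ∷ _} (there a∈)  = there (∼∈⇒∈⁻ a∈)
  ∼∈⇒∈⁻ {ls = pos _ ∷ _} (there a∈)  = ∼∈⇒∈⁻ a∈

  ∈⁻⇒∼∈ : {T : Set} {ls : List (Literal T)} {a : Atom T} → a ∈ ls ⁻ → (∼ a) ∈ ls
  ∈⁻⇒∼∈ {ls = (∼ _) ∷ _} (here refl) = here refl
  ∈⁻⇒∼∈ {ls = (∼ _) ∷ _} (there a∈)  = there (∈⁻⇒∼∈ a∈)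
  ∈⁻⇒∼∈ {ls = pos _ ∷ _} a∈          = there (∈⁻⇒∼∈ a∈)

  pos∈? : (I : LiteralSet) → Decidable (λ a → pos a ∈ I)
  pos∈? I a with DecMembership._∈?_ _≟ᵍ_ a (I ⁺)
  ... | yes a∈ = yes (∈⁺⇒pos∈ a∈)
  ... | no a∉  = no (a∉ ∘ pos∈⇒∈⁺)

  B? : (Q : Program) → Decidable (B Q)
  B? Q a = (pred a ∈ⁿ? preds Q) ×-dec VecAll.all? (_∈ⁿ? U Q) (args a)

  B-mono : {Q R : Program} → preds Q ⊆ preds R → U Q ⊆ U R → ∀ {a} → B Q a → B R a
  B-mono ps us (p∈ , cs∈) = ps p∈ , VecAll.map us cs∈

  U-mono : ∀ {Q R} → Q ⊆ R → U Q ⊆ U R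
  U-mono = concatMap⁺ (concatMap consᵗ ∘ termsᵃ ∘ atoms)

  preds-mono : ∀ {Q R} → Q ⊆ R → preds Q ⊆ preds R
  preds-mono = concatMap⁺ (map pred ∘ atoms)

  inst : (Variable → Constant) → Atom Term → Atom Constant
  inst σ = mapAtom (substᵗ σ)

  head⊆atoms : {r : Rule Term} → head r ⊆ atoms r
  head⊆atoms = ∈-++⁺ˡ

  body⊆atoms : {r : Rule Term} {l : Literal Term} → l ∈ body r → atomOf l ∈ atoms r
  body⊆atoms {r} l∈ = ∈-++⁺ʳ (head r) (∈-map⁺ atomOf l∈)

  pred∈preds : {Q : Program} {r : Rule Term} {a : Atom Term} →
    r ∈ Q → a ∈ atoms r → pred a ∈ preds Q
  pred∈preds r∈Q a∈r = ∈-concatMap⁺′ (map pred ∘ atoms) r∈Q (∈-map⁺ pred a∈r)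

  pred∈headPreds : {Q : Program} {r : Rule Term} {h : Atom Term} →
    r ∈ Q → h ∈ head r → pred h ∈ headPreds Q
  pred∈headPreds r∈Q h∈r = ∈-concatMap⁺′ (map pred ∘ head) r∈Q (∈-map⁺ pred h∈r)

  -- Instances

  Grounded : Program → (Variable → Constant) → Rule Term → Set
  Grounded Q σ r = ∀ x → x ∈ vars (atoms r) → σ x ∈ U Q

  grounded⇒base : {Q : Program} {σ : Variable → Constant} {r : Rule Term} {a : Atom Term} →
    r ∈ Q → Grounded Q σ r → a ∈ atoms r → B Q (inst σ a)
  grounded⇒base {Q} {σ} {r} {a} r∈Q gr a∈r =
    pred∈preds r∈Q a∈r , allMap⁺ (args a) (λ {t} → value t)
    where
    value : ∀ t → t ∈ toList (args a) → substᵗ σ t ∈ U Q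
    value t t∈a with t | ∈-concatMap⁺′ (toList ∘ args) a∈r t∈a
    ... | var x | t∈r = gr x (∈-concatMap⁺′ varsᵗ t∈r (here refl))
    ... | con c | t∈r = ∈-concatMap⁺′ (concatMap consᵗ ∘ termsᵃ ∘ atoms) r∈Q
                          (∈-concatMap⁺′ consᵗ t∈r (here refl))

  -- Each variable of a safe rule occurs in a positive body atom, and the instance of that atom
  -- already has its arguments in `U Q`. The rule need not belong to `Q`, so groundings can be moved
  -- between programs.
  safe⇒grounded : {Q : Program} {σ : Variable → Constant} {r : Rule Term} → Safe r →
    (∀ b → pos b ∈ body r → B Q (inst σ b)) → Grounded Q σ r
  safe⇒grounded {Q} {σ} safe base x x∈r
    with ∈-concatMap⁻′ varsᵗ (safe x∈r)
  ... | var _ , t∈body , here refl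
    with ∈-concatMap⁻′ (toList ∘ args) t∈body
  ... | b , b∈body , t∈b = allMap⁻ (args b) (proj₂ (base b (∈⁺⇒pos∈ b∈body))) t∈b

  -- Satisfaction stated on rules and substitutions

  -- Safety, separation and stratification speak of rules with variables, so the later arguments
  -- work with a rule and a substitution instead of a ground rule.
  TrueHead : LiteralSet → (Variable → Constant) → Rule Term → Set
  TrueHead I σ r = ∃[ h ] h ∈ head r × pos (inst σ h) ∈ I

  applyModel : {Q : Program} {I : LiteralSet} → Satisfies I (Ground Q) →
    {r : Rule Term} (σ : Variable → Constant) → r ∈ Q → Grounded Q σ r →
    (∀ {l} → l ∈ body r → mapLiteral (substᵗ σ) l ∈ I) → TrueHead I σ r
  applyModel sat {r} σ r∈Q gr holds =
    find (Anyₚ.map⁻ (sat _ (r , σ , r∈Q , (λ {x} → gr x) , refl) (Allₚ.map⁺ (All.tabulate holds))))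

  mkModel : {Q : Program} {I : LiteralSet} →
    (∀ {r} σ → r ∈ Q → Grounded Q σ r →
      (∀ {l} → l ∈ body r → mapLiteral (substᵗ σ) l ∈ I) → TrueHead I σ r) →
    Satisfies I (Ground Q)
  mkModel sat _ (r , σ , r∈Q , gr , refl) holds
    with sat σ r∈Q (λ _ → gr) (All.lookup (Allₚ.map⁻ holds))
  ... | h , h∈r , h∈I = Anyₚ.map⁺ (lose h∈r h∈I)

  applyReduct : {Q : Program} {I J : LiteralSet} → Satisfies J (Reduct (Ground Q) I) →
    {r : Rule Term} (σ : Variable → Constant) → r ∈ Q → Grounded Q σ r →
    (∀ b → pos b ∈ body r → pos (inst σ b) ∈ J) →
    (∀ b → (∼ b) ∈ body r → (∼ inst σ b) ∈ I) → TrueHead J σ r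
  applyReduct {I = I} {J} sat {r} σ r∈Q gr holds⁺ holds⁻ =
    find (Anyₚ.map⁻ (sat _
      (_ , (r , σ , r∈Q , (λ {x} → gr x) , refl) , All.tabulate (λ b∈ → neg (∈⁻⇒∼∈ b∈)) , refl)
      (Allₚ.map⁺ (All.tabulate (λ b∈ → posi (∈⁺⇒pos∈ b∈))))))
    where
    posi : ∀ {a} → pos a ∈ map (mapLiteral (substᵗ σ)) (body r) → pos a ∈ J
    posi a∈ with ∈-map⁻ _ a∈
    ... | pos b , b∈r , refl = holds⁺ b b∈r
    neg : ∀ {a} → (∼ a) ∈ map (mapLiteral (substᵗ σ)) (body r) → (∼ a) ∈ I
    neg a∈ with ∈-map⁻ _ a∈
    ... | ∼ b , b∈r , refl = holds⁻ b b∈r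

  mkReduct : {Q : Program} {I J : LiteralSet} →
    (∀ {r} σ → r ∈ Q → Grounded Q σ r →
      (∀ b → pos b ∈ body r → pos (inst σ b) ∈ J) →
      (∀ b → (∼ b) ∈ body r → (∼ inst σ b) ∈ I) → TrueHead J σ r) →
    Satisfies J (Reduct (Ground Q) I)
  mkReduct sat _ (_ , (r , σ , r∈Q , gr , refl) , negs , refl) holds
    with sat σ r∈Q (λ _ → gr)
           (λ b b∈r → All.lookup (Allₚ.map⁻ holds) (pos∈⇒∈⁺ (∈-map⁺ (mapLiteral (substᵗ σ)) b∈r)))
           (λ b b∈r → All.lookup negs (∼∈⇒∈⁻ (∈-map⁺ (mapLiteral (substᵗ σ)) b∈r)))
  ... | h , h∈r , h∈J = Anyₚ.map⁺ (lose h∈r h∈J)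

  -- Minimality

  module Demote {X : Atom Constant → Set} (X? : Decidable X) where

    -- Atoms outside `X` become false instead of disappearing, which keeps the interpretation total
    -- over the same base.
    demote : Literal Constant → Literal Constant
    demote (∼ a) = ∼ a
    demote (pos a) with X? a
    ... | yes _ = pos a
    ... | no _  = ∼ a

    pos∈demote⁺ : ∀ {a I} → pos a ∈ I → X a → pos a ∈ map demote I
    pos∈demote⁺ {a} a∈I xa with X? a | ∈-map⁺ demote a∈I
    ... | yes _  | a∈ = a∈
    ... | no ¬xa | _  = ⊥-elim (¬xa xa)

    pos∈demote⁻ : ∀ {a I} → pos a ∈ map demote I → pos a ∈ I × X a
    pos∈demote⁻ a∈ with ∈-map⁻ demote a∈
    ... | pos b , b∈I , e with X? b
    pos∈demote⁻ a∈ | pos b , b∈I , refl | yes xb = b∈I , xb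

    ∼∈demote⁻ : ∀ {a I} → (∼ a) ∈ map demote I → (∼ a) ∈ I ⊎ ¬ X a
    ∼∈demote⁻ a∈ with ∈-map⁻ demote a∈
    ... | ∼ b , b∈I , refl = inj₁ b∈I
    ... | pos b , b∈I , e with X? b
    ∼∈demote⁻ a∈ | pos b , b∈I , refl | no ¬xb = inj₂ ¬xb

    atomOf-demote : ∀ l → atomOf (demote l) ≡ atomOf l
    atomOf-demote (∼ a) = refl
    atomOf-demote (pos a) with X? a
    ... | yes _ = refl
    ... | no _  = refl

    demote-interpretation : ∀ {Q I} → IsInterpretation Q I → IsInterpretation Q (map demote I)
    demote-interpretation {Q} {I} int = record
      { consistent = λ a (a∈ , ∼a∈) →
          [ (λ ∼a∈I → consistent a (proj₁ (pos∈demote⁻ a∈) , ∼a∈I))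
          , (λ ¬xa → ¬xa (proj₂ (pos∈demote⁻ a∈))) ]′ (∼∈demote⁻ ∼a∈)
      ; total      = λ a a∈B → tot a (total a a∈B)
      ; overBase   = base
      }
      where
      open IsInterpretation int
      tot : ∀ a → pos a ∈ I ⊎ (∼ a) ∈ I → pos a ∈ map demote I ⊎ (∼ a) ∈ map demote I
      tot a (inj₂ ∼a∈I) = inj₂ (∈-map⁺ demote ∼a∈I)
      tot a (inj₁ a∈I) with X? a | ∈-map⁺ demote a∈I
      ... | yes _ | a∈ = inj₁ a∈
      ... | no _  | a∈ = inj₂ a∈
      base : ∀ l → l ∈ map demote I → B Q (atomOf l)
      base l l∈ =
        let k , k∈I , l≡ = ∈-map⁻ demote l∈
        in subst (B Q) (trans (sym (atomOf-demote k)) (cong atomOf (sym l≡))) (overBase k k∈I)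

  -- An induction principle for the true atoms of an answer set. Demoting the atoms outside `X`
  -- leaves a model of the reduct, so by minimality there are none to demote. Since a rule may be
  -- disjunctive, `closed` may answer a true head atom `h` with another true head atom that
  -- satisfies `X`.
  minimal⇒⊆ : {Q : Program} {M : LiteralSet} → IsAnswerSet Q M →
    {X : Atom Constant → Set} → Decidable X →
    (∀ {r} σ → r ∈ Q → Grounded Q σ r →
      (∀ b → pos b ∈ body r → pos (inst σ b) ∈ M × X (inst σ b)) →
      (∀ b → (∼ b) ∈ body r → (∼ inst σ b) ∈ M) →
      ∀ h → h ∈ head r → pos (inst σ h) ∈ M →
      ∃[ h′ ] h′ ∈ head r × pos (inst σ h′) ∈ M × X (inst σ h′)) →
    ∀ {a} → pos a ∈ M → X a
  minimal⇒⊆ {Q} {M} as {X} X? closed {a} a∈M =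
    decidable-stable (X? a) λ ¬xa → minimal
      ( map demote M , demote-interpretation interpretation , mkReduct sat
      , (pos∈⇒∈⁺ ∘ proj₁ ∘ pos∈demote⁻ {I = M} ∘ ∈⁺⇒pos∈)
      , λ M⊆ → ¬xa (proj₂ (pos∈demote⁻ {I = M} (∈⁺⇒pos∈ (M⊆ (pos∈⇒∈⁺ a∈M))))) )
    where
    open IsAnswerSet as
    open Demote X?
    sat : ∀ {r} σ → r ∈ Q → Grounded Q σ r →
      (∀ b → pos b ∈ body r → pos (inst σ b) ∈ map demote M) →
      (∀ b → (∼ b) ∈ body r → (∼ inst σ b) ∈ M) → TrueHead (map demote M) σ r
    sat σ r∈Q gr holds⁺ holds⁻
      -- Whatever survives demotion is true in `M`, so the original model supplies the head atom to
      -- which `closed` is applied.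
      with applyModel model σ r∈Q gr
             (λ { {pos b} b∈r → proj₁ (pos∈demote⁻ (holds⁺ b b∈r)) ; {∼ b} b∈r → holds⁻ b b∈r })
    ... | h , h∈r , h∈M
      with closed σ r∈Q gr (λ b b∈r → pos∈demote⁻ (holds⁺ b b∈r)) holds⁻ h h∈r h∈M
    ... | h′ , h′∈r , h′∈M , xh′ = h′ , h′∈r , pos∈demote⁺ h′∈M xh′

  -- Uniqueness for stratified programs

  Agree : LiteralSet → LiteralSet → Predicate → Set
  Agree I J p = ∀ a → pred a ≡ p → (pos a ∈ I → pos a ∈ J) × (pos a ∈ J → pos a ∈ I)

  agree-sym : {I J : LiteralSet} {p : Predicate} → Agree I J p → Agree J I p
  agree-sym ag a e = swap (ag a e)

  _++ʷ_ : {Q : Program} {p q r : Predicate} {ss ts : List Sign} →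
    Walk Q p q ss → Walk Q q r ts → Walk Q p r (ss ++ ts)
  []      ++ʷ w = w
  (e ∷ v) ++ʷ w = e ∷ (v ++ʷ w)

  -- For a stratified program this is a strict order: a predicate strictly below itself would lie on
  -- a closed walk with a negative edge.
  StrictlyBelow : Program → Predicate → Predicate → Set
  StrictlyBelow Q q p = ∃[ ss ] Walk Q q p ss × negative ∈ ss

  strictlyBelow-trans : {Q : Program} {o q p : Predicate} →
    StrictlyBelow Q o q → StrictlyBelow Q q p → StrictlyBelow Q o p
  strictlyBelow-trans (_ , v , n∈) (_ , w , _) = _ , v ++ʷ w , ∈-++⁺ˡ n∈

  -- Two distinct head atoms give disjunctive edges in both directions between their predicates,
  -- hence a negative closed walk.
  stratified⇒single-head : {Q : Program} → Stratified Q → ∀ {r h h′} →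
    r ∈ Q → h ∈ head r → h′ ∈ head r → h ≡ h′
  stratified⇒single-head strat {r} {h} {h′} r∈Q h∈r h′∈r =
    decidable-stable (h ≟ᵃ h′) λ h≢h′ →
      strat (disjunctive r∈Q h∈r h′∈r h≢h′ refl refl
           ∷ disjunctive r∈Q h′∈r h∈r (h≢h′ ∘ sym) refl refl ∷ []) (here refl)

  module Uniqueness (F : List (Atom Constant)) (ρ : Program) (strat : Stratified ρ) where

    P : Program
    P = map fact F ++ ρ

    -- Everything that the rules for `D` consult outside `D`, or under negation, has already been
    -- settled equally in `I` and `J`.
    Closed : LiteralSet → LiteralSet → List Predicate → Set
    Closed I J D = ∀ {r h} → r ∈ ρ → h ∈ head r → pred h ∈ D →
      (∀ b → pos b ∈ body r → pred b ∈ D ⊎ Agree I J (pred b)) ×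
      (∀ b → (∼ b) ∈ body r → Agree I J (pred b))

    -- Induction over the atoms of `N₁` for the property `pred a ∈ D → pos a ∈ N₂`, which holds
    -- trivially outside `D`. A rule of `ρ` deriving into `D` has its body true in `N₂` as well, so
    -- `N₂` makes some head atom true, and there is only one to choose. Facts hold in both answer
    -- sets.
    closed-⊆ : {N₁ N₂ : LiteralSet} → IsAnswerSet P N₁ → IsAnswerSet P N₂ →
      {D : List Predicate} → Closed N₁ N₂ D → ∀ {a} → pos a ∈ N₁ → pred a ∈ D → pos a ∈ N₂
    closed-⊆ {N₁} {N₂} as₁ as₂ {D} closed =
      minimal⇒⊆ as₁ (λ a → (pred a ∈ⁿ? D) →-dec pos∈? N₂ a) step
      where
      module A₁ = IsAnswerSet as₁
      module A₂ = IsAnswerSet as₂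
      module I₁ = IsInterpretation A₁.interpretation
      module I₂ = IsInterpretation A₂.interpretation

      fact-true : ∀ {r h} σ → r ∈ map fact F → Grounded P σ r → h ∈ head r → pos (inst σ h) ∈ N₂
      fact-true σ r∈F gr h∈r with ∈-map⁻ fact r∈F
      fact-true σ r∈F gr (here refl) | _ , _ , refl with applyModel A₂.model σ (∈-++⁺ˡ r∈F) gr (λ ())
      ... | _ , here refl , h∈N₂ = h∈N₂

      step : ∀ {r} σ → r ∈ P → Grounded P σ r →
        (∀ b → pos b ∈ body r → pos (inst σ b) ∈ N₁ × (pred b ∈ D → pos (inst σ b) ∈ N₂)) →
        (∀ b → (∼ b) ∈ body r → (∼ inst σ b) ∈ N₁) →
        ∀ h → h ∈ head r → pos (inst σ h) ∈ N₁ →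
        ∃[ h′ ] h′ ∈ head r × pos (inst σ h′) ∈ N₁ × (pred h′ ∈ D → pos (inst σ h′) ∈ N₂)
      step {r} σ r∈P gr holds⁺ holds⁻ h h∈r h∈N₁ = h , h∈r , h∈N₁ , derive (∈-++⁻ (map fact F) r∈P)
        where
        derive : r ∈ map fact F ⊎ r ∈ ρ → pred h ∈ D → pos (inst σ h) ∈ N₂
        derive (inj₁ r∈F) _ = fact-true σ r∈F gr h∈r
        derive (inj₂ r∈ρ) h∈D with closed r∈ρ h∈r h∈D
        ... | body⁺-ok , body⁻-ok
          with applyModel A₂.model σ r∈P gr (λ { {pos b} b∈r → holds₂⁺ b b∈r ; {∼ b} b∈r → holds₂⁻ b b∈r })
          where
          holds₂⁺ : ∀ b → pos b ∈ body r → pos (inst σ b) ∈ N₂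
          holds₂⁺ b b∈r = [ proj₂ (holds⁺ b b∈r)
                          , (λ ag → proj₁ (ag (inst σ b) refl) (proj₁ (holds⁺ b b∈r))) ]′ (body⁺-ok b b∈r)
          holds₂⁻ : ∀ b → (∼ b) ∈ body r → (∼ inst σ b) ∈ N₂
          holds₂⁻ b b∈r =
            -- If the atom were true in `N₂`, agreement would make it true in `N₁` beside its
            -- negation. Totality of `N₂` applies because both interpretations have the base of `P`.
            [ (λ b∈N₂ → ⊥-elim (I₁.consistent _ (proj₂ (body⁻-ok b b∈r (inst σ b) refl) b∈N₂ , holds⁻ b b∈r)))
            , id ]′ (I₂.total (inst σ b) (I₁.overBase _ (holds⁻ b b∈r)))
        ... | h′ , h′∈r , h′∈N₂ with stratified⇒single-head strat r∈ρ h∈r h′∈r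
        ...   | refl = h′∈N₂

    module _ {N₁ N₂ : LiteralSet} (as₁ : IsAnswerSet P N₁) (as₂ : IsAnswerSet P N₂) where

      closed-agree : {D : List Predicate} → Closed N₁ N₂ D → ∀ {a} → pred a ∈ D →
        (pos a ∈ N₁ → pos a ∈ N₂) × (pos a ∈ N₂ → pos a ∈ N₁)
      closed-agree closed a∈D =
          (λ a∈N₁ → closed-⊆ as₁ as₂ closed a∈N₁ a∈D)
        , (λ a∈N₂ → closed-⊆ as₂ as₁ closed′ a∈N₂ a∈D)
        where
        closed′ : Closed N₂ N₁ _
        closed′ r∈ρ h∈r h∈D with closed r∈ρ h∈r h∈D
        ... | ok⁺ , ok⁻ = (λ b b∈ → ⊎-map₂ agree-sym (ok⁺ b b∈)) , (λ b b∈ → agree-sym (ok⁻ b b∈))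

      -- Only the facts can derive `p`, and they are common to both answer sets: the singleton of
      -- `p` is vacuously closed.
      agree-extensional : ∀ {p} → p ∉ headPreds ρ → Agree N₁ N₂ p
      agree-extensional {p} p∉ a refl = closed-agree {D = p ∷ []} vacuous (here refl)
        where
        vacuous : Closed N₁ N₂ (p ∷ [])
        vacuous r∈ρ h∈r (here refl) = ⊥-elim (p∉ (pred∈headPreds r∈ρ h∈r))

      -- Let `D` consist of the head predicates that reach `p`. Positive premises of rules for `D`
      -- reach `p` too, while a negative premise reaches it through a negative edge and so is
      -- strictly below `p`. Premises that head no rule of `ρ` agree extensionally.
      agree-step : ∀ {p} → p ∈ headPreds ρ →
        (∀ {q} → q ∈ headPreds ρ → StrictlyBelow ρ q p → Agree N₁ N₂ q) → Agree N₁ N₂ p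
      agree-step {p} p∈ below a refl =
          -- The list `D` is only available under double negation, which membership in an
          -- interpretation, being decidable, absorbs.
          (λ a∈N₁ → decidable-stable (pos∈? N₂ a) λ k → ¬¬-agree λ ag → k (proj₁ ag a∈N₁))
        , (λ a∈N₂ → decidable-stable (pos∈? N₁ a) λ k → ¬¬-agree λ ag → k (proj₂ ag a∈N₂))
        where
        Ancestor : Predicate → Set
        Ancestor q = ∃[ ss ] Walk ρ q p ss

        ancestors-closed : {D : List Predicate} → (∀ {q} → q ∈ D → Ancestor q) →
          (∀ {q} → q ∈ headPreds ρ → Ancestor q → q ∈ D) → Closed N₁ N₂ D
        ancestors-closed {D} sound complete {r} r∈ρ h∈r h∈D =
            (λ b b∈r → case⁺ b b∈r (pred b ∈ⁿ? headPreds ρ))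
          , (λ b b∈r → case⁻ b b∈r (pred b ∈ⁿ? headPreds ρ))
          where
          case⁺ : ∀ b → pos b ∈ body r → Dec (pred b ∈ headPreds ρ) → pred b ∈ D ⊎ Agree N₁ N₂ (pred b)
          case⁺ b b∈r (no b∉)  = inj₂ (agree-extensional b∉)
          case⁺ b b∈r (yes b∈) = inj₁ (complete b∈
            (_ , positiveBody r∈ρ b∈ (∈-map⁺ pred (pos∈⇒∈⁺ b∈r)) (∈-map⁺ pred h∈r) ∷ proj₂ (sound h∈D)))
          case⁻ : ∀ b → (∼ b) ∈ body r → Dec (pred b ∈ headPreds ρ) → Agree N₁ N₂ (pred b)
          case⁻ b b∈r (no b∉)  = agree-extensional b∉
          case⁻ b b∈r (yes b∈) = below b∈
            (_ , negativeBody r∈ρ b∈ (∈-map⁺ pred (∼∈⇒∈⁻ b∈r)) (∈-map⁺ pred h∈r) ∷ proj₂ (sound h∈D) , here refl)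

        ¬¬-agree : ¬ ¬ ((pos a ∈ N₁ → pos a ∈ N₂) × (pos a ∈ N₂ → pos a ∈ N₁))
        ¬¬-agree k = ¬¬-sublist Ancestor (headPreds ρ) λ (D , sound , complete) →
          k (closed-agree (ancestors-closed sound complete) (complete p∈ (_ , [])))

      -- C bounds the predicates strictly below p; it shrinks at each descent
      -- because no predicate is strictly below itself.
      agree-below : ∀ n (C : List Predicate) {p} → length C < n → p ∈ headPreds ρ →
        (∀ {q} → StrictlyBelow ρ q p → q ∈ headPreds ρ → q ∈ C) → Agree N₁ N₂ p
      agree-below (suc n) C {p} (s≤s |C|≤n) p∈ bound = agree-step p∈ λ {q} q∈ q<p →
        agree-below n (filter (λ o → ¬? (o Nat.≟ q)) C)
          (≤-trans (filter-notAll (λ o → ¬? (o Nat.≟ q)) C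
                     (Any.map (λ { refl o≢q → o≢q refl }) (bound q<p q∈))) |C|≤n)
          q∈
          (λ o<q o∈ → ∈-filter⁺ (λ o → ¬? (o Nat.≟ q)) (bound (strictlyBelow-trans o<q q<p) o∈)
            (λ { refl → strat (proj₁ (proj₂ o<q)) (proj₂ (proj₂ o<q)) }))

      agree : ∀ p → Agree N₁ N₂ p
      agree p with p ∈ⁿ? headPreds ρ
      ... | yes p∈ = agree-below _ (headPreds ρ) ≤-refl p∈ (λ _ q∈ → q∈)
      ... | no p∉  = agree-extensional p∉

      answerSet-unique : N₁ ≈⁺ N₂
      answerSet-unique =
          (λ {a} a∈ → pos∈⇒∈⁺ (proj₁ (agree (pred a) a refl) (∈⁺⇒pos∈ a∈)))
        , (λ {a} a∈ → pos∈⇒∈⁺ (proj₂ (agree (pred a) a refl) (∈⁺⇒pos∈ a∈)))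

  -- Splitting an answer set

  restrict : Program → LiteralSet → LiteralSet
  restrict Q = filter (B? Q ∘ atomOf)

  restrict⁺ : ∀ {Q I l} → l ∈ I → B Q (atomOf l) → l ∈ restrict Q I
  restrict⁺ {Q} = ∈-filter⁺ (B? Q ∘ atomOf)

  restrict⁻ : ∀ {Q I l} → l ∈ restrict Q I → l ∈ I × B Q (atomOf l)
  restrict⁻ {Q} = ∈-filter⁻ (B? Q ∘ atomOf)

  restrict-interpretation : ∀ {Q R I} → (∀ {a} → B Q a → B R a) →
    IsInterpretation R I → IsInterpretation Q (restrict Q I)
  restrict-interpretation {Q} {I = I} Q⊆R int = record
    { consistent = λ a (a∈ , ∼a∈) → consistent a (proj₁ (restrict⁻ {Q} {I} a∈) , proj₁ (restrict⁻ {Q} {I} ∼a∈))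
    ; total      = λ a a∈B → [ (λ a∈ → inj₁ (restrict⁺ {Q} a∈ a∈B)) , (λ ∼a∈ → inj₂ (restrict⁺ {Q} ∼a∈ a∈B)) ]′
                               (total a (Q⊆R a∈B))
    ; overBase   = λ l l∈ → proj₂ (restrict⁻ {Q} {I} l∈)
    }
    where open IsInterpretation int

  -- The head atom that `I` makes true survives the restriction because the rule belongs to `Q` and
  -- is grounded over `U Q`.
  restrict-rule : ∀ {Q R I} → Satisfies I (Ground R) → U Q ⊆ U R →
    ∀ {r} σ → r ∈ R → r ∈ Q → Grounded Q σ r →
    (∀ {l} → l ∈ body r → mapLiteral (substᵗ σ) l ∈ restrict Q I) → TrueHead (restrict Q I) σ r
  restrict-rule {Q} {I = I} sat UQ⊆UR σ r∈R r∈Q gr holds =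
    let h , h∈r , h∈I = applyModel sat σ r∈R (λ x → UQ⊆UR ∘ gr x) (proj₁ ∘ restrict⁻ {Q} {I} ∘ holds)
    in h , h∈r , restrict⁺ {Q} h∈I (grounded⇒base r∈Q gr (head⊆atoms h∈r))

  -- Ground atoms as facts.

  fact-inst : ∀ σ (a : Atom Constant) → inst σ (mapAtom con a) ≡ a
  fact-inst σ (atom p cs) = cong (atom p) (trans (sym (Vecₚ.map-∘ (substᵗ σ) con cs)) (Vecₚ.map-id cs))

  trueFact : ∀ {I a} σ → TrueHead I σ (fact a) → pos a ∈ I
  trueFact {I} {a} σ (_ , here refl , a∈I) = subst (λ b → pos b ∈ I) (fact-inst σ a) a∈I

  fact-term : ∀ (a : Atom Constant) {t} → t ∈ termsᵃ (atoms (fact a)) → ∃[ c ] c ∈ toList (args a) × t ≡ con c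
  fact-term a {t} t∈ with ∈-concatMap⁻′ (toList ∘ args) {mapAtom con a ∷ []} t∈
  ... | _ , here refl , t∈a = ∈-map⁻ con (subst (t ∈_) (Vecₚ.toList-map con (args a)) t∈a)

  fact-grounded : ∀ {Q} σ a → Grounded Q σ (fact a)
  fact-grounded σ a x x∈ with ∈-concatMap⁻′ varsᵗ {termsᵃ (atoms (fact a))} x∈
  ... | t , t∈ , x∈t with fact-term a t∈
  fact-grounded σ a x x∈ | _ , _ , () | _ , _ , refl

  preds-fact : ∀ a {p} → p ∈ map pred (atoms (fact a)) → p ≡ pred a
  preds-fact a (here p≡) = p≡

  cons-fact : ∀ a {c} → c ∈ concatMap consᵗ (termsᵃ (atoms (fact a))) → c ∈ toList (args a)
  cons-fact a c∈ with ∈-concatMap⁻′ consᵗ {termsᵃ (atoms (fact a))} c∈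
  ... | t , t∈ , c∈t with fact-term a t∈
  cons-fact a c∈ | _ , _ , here refl | _ , c∈a , refl = c∈a

  facts-base : ∀ {F Q R} → (∀ {a} → a ∈ F → B R a) → Q ⊆ R →
    preds (map fact F ++ Q) ⊆ preds R × U (map fact F ++ Q) ⊆ U R
  facts-base {F} {Q} {R} F⊆ Q⊆R =
      concatMap-⊆ predsʳ {map fact F ++ Q} (λ r∈ → [ (λ r∈F → factPreds (∈-map⁻ fact r∈F))
                              , (λ r∈Q → ∈-concatMap⁺′ predsʳ (Q⊆R r∈Q)) ]′ (∈-++⁻ (map fact F) r∈))
    , concatMap-⊆ consʳ {map fact F ++ Q} (λ r∈ → [ (λ r∈F → factCons (∈-map⁻ fact r∈F))
                             , (λ r∈Q → ∈-concatMap⁺′ consʳ (Q⊆R r∈Q)) ]′ (∈-++⁻ (map fact F) r∈))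
    where
    predsʳ : Rule Term → List Predicate
    predsʳ = map pred ∘ atoms
    consʳ : Rule Term → List Constant
    consʳ = concatMap consᵗ ∘ termsᵃ ∘ atoms
    factPreds : ∀ {r} → ∃[ a ] a ∈ F × r ≡ fact a → predsʳ r ⊆ preds R
    factPreds (a , a∈F , refl) p∈ = subst (_∈ preds R) (sym (preds-fact a p∈)) (proj₁ (F⊆ a∈F))
    factCons : ∀ {r} → ∃[ a ] a ∈ F × r ≡ fact a → consʳ r ⊆ U R
    factCons (a , a∈F , refl) c∈ = VecAll.lookup (proj₂ (F⊆ a∈F)) (∈-toList⁻ (cons-fact a c∈))

  -- Recovering the answer set from facts and the stratified sub-program.

  module Recombination (π ρ : Program) (safe : All Safe π) (ρ⊆π : ρ ⊆ π) (strat : Stratified ρ)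
                       {M : LiteralSet} (as : IsAnswerSet π M)
                       {F : List (Atom Constant)} (F⊆M : ∀ {a} → a ∈ F → pos a ∈ M)
                       (derived∈F : ∀ {r h} σ → r ∈ π → r ∉ ρ → h ∈ head r →
                                    pos (inst σ h) ∈ M → inst σ h ∈ F) where

    open IsAnswerSet as
    open IsInterpretation interpretation
    open Uniqueness F ρ strat using (P; answerSet-unique)

    ρ⊆P : ρ ⊆ P
    ρ⊆P = ∈-++⁺ʳ (map fact F)

    fact∈P : ∀ {a} → a ∈ F → fact a ∈ P
    fact∈P a∈ = ∈-++⁺ˡ (∈-map⁺ fact a∈)

    -- Facts are ground, so any substitution will do.
    σ₀ : Variable → Constant
    σ₀ _ = 0

    F⊆BP : ∀ {a} → a ∈ F → B P a
    F⊆BP {a} a∈ = subst (B P) (fact-inst σ₀ a)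
      (grounded⇒base {P} (fact∈P a∈) (fact-grounded {P} σ₀ a) (here refl))

    P-base : preds P ⊆ preds π × U P ⊆ U π
    P-base = facts-base (λ {a} a∈ → overBase (pos a) (F⊆M a∈)) ρ⊆π

    ground-safe : ∀ {r} σ → r ∈ π → (∀ b → pos b ∈ body r → B P (inst σ b)) → Grounded P σ r
    ground-safe {r} σ r∈π = safe⇒grounded {P} {σ} {r} (All.lookup safe r∈π)

    -- The base of `P` may be smaller than that of `π`, so it must be checked that restricting `M`
    -- to it loses no true atom. By induction, a rule of `ρ` with its positive body in the base is
    -- grounded over `U P` by safety, and true heads of all other rules are among the facts.
    M⊆BP : ∀ {a} → pos a ∈ M → B P a
    M⊆BP = minimal⇒⊆ as (B? P) step
      where
      step : ∀ {r} σ → r ∈ π → Grounded π σ r →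
        (∀ b → pos b ∈ body r → pos (inst σ b) ∈ M × B P (inst σ b)) →
        (∀ b → (∼ b) ∈ body r → (∼ inst σ b) ∈ M) →
        ∀ h → h ∈ head r → pos (inst σ h) ∈ M →
        ∃[ h′ ] h′ ∈ head r × pos (inst σ h′) ∈ M × B P (inst σ h′)
      step {r} σ r∈π _ holds⁺ _ h h∈r h∈M = h , h∈r , h∈M ,
        [ (λ r∈ρ → grounded⇒base {P} (ρ⊆P r∈ρ) (ground-safe σ r∈π λ b b∈r → proj₂ (holds⁺ b b∈r)) (head⊆atoms h∈r))
        , (λ r∉ρ → F⊆BP (derived∈F σ r∈π r∉ρ h∈r h∈M))
        ]′ (toSum (r ∈? ρ))

    N : LiteralSet
    N = restrict P M

    N-model : Satisfies N (Ground P)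
    N-model = mkModel λ σ r∈P gr holds →
      [ (λ r∈F → factHead σ (∈-map⁻ fact r∈F))
      , (λ r∈ρ → restrict-rule {P} model (proj₂ P-base) σ (ρ⊆π r∈ρ) r∈P gr holds)
      ]′ (∈-++⁻ (map fact F) r∈P)
      where
      factHead : ∀ {r} σ → ∃[ a ] a ∈ F × r ≡ fact a → TrueHead N σ r
      factHead σ (a , a∈ , refl) = _ , here refl , subst (λ b → pos b ∈ N) (sym (fact-inst σ a))
        (restrict⁺ {P} {M} (F⊆M a∈) (F⊆BP a∈))

    -- Membership in `J` is preserved by every rule of `π` that is active in `M`: a rule of `ρ`
    -- fires in the reduct by `N`, and a true head of any other rule is a fact, which `J` must
    -- contain. Minimality of `M` then puts all of `M`, and with it `N`, inside `J`.
    N-minimal : ¬ (∃[ J ] IsInterpretation P J × Satisfies J (Reduct (Ground P) N) × J ⁺ ⊊ N ⁺)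
    N-minimal (J , _ , sat , J⊆ , J⊉) =
      J⊉ λ a∈ → pos∈⇒∈⁺ {ls = J} (minimal⇒⊆ as (pos∈? J) step (proj₁ (restrict⁻ {P} {M} (∈⁺⇒pos∈ {ls = N} a∈))))
      where
      F⊆J : ∀ {a} → a ∈ F → pos a ∈ J
      F⊆J {a} a∈ = trueFact σ₀
        (applyReduct {P} {N} {J} sat σ₀ (fact∈P a∈) (fact-grounded {P} σ₀ a) (λ _ ()) (λ _ ()))

      J⊆M : ∀ {a} → pos a ∈ J → pos a ∈ M
      J⊆M a∈ = proj₁ (restrict⁻ {P} {M} (∈⁺⇒pos∈ {ls = N} (J⊆ (pos∈⇒∈⁺ {ls = J} a∈))))

      step : ∀ {r} σ → r ∈ π → Grounded π σ r →
        (∀ b → pos b ∈ body r → pos (inst σ b) ∈ M × pos (inst σ b) ∈ J) →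
        (∀ b → (∼ b) ∈ body r → (∼ inst σ b) ∈ M) →
        ∀ h → h ∈ head r → pos (inst σ h) ∈ M →
        ∃[ h′ ] h′ ∈ head r × pos (inst σ h′) ∈ M × pos (inst σ h′) ∈ J
      step {r} σ r∈π _ holds⁺ holds⁻ h h∈r h∈M =
        [ (λ r∈ρ → inM×J (fire r∈ρ))
        , (λ r∉ρ → h , h∈r , h∈M , F⊆J (derived∈F σ r∈π r∉ρ h∈r h∈M))
        ]′ (toSum (r ∈? ρ))
        where
        grounded : Grounded P σ r
        grounded = ground-safe σ r∈π λ b b∈r → M⊆BP (proj₁ (holds⁺ b b∈r))

        body⁻-true : r ∈ ρ → ∀ b → (∼ b) ∈ body r → (∼ inst σ b) ∈ N
        body⁻-true r∈ρ b b∈r =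
          restrict⁺ {P} {M} (holds⁻ b b∈r) (grounded⇒base {P} (ρ⊆P r∈ρ) grounded (body⊆atoms b∈r))

        fire : r ∈ ρ → TrueHead J σ r
        fire r∈ρ = applyReduct {P} {N} {J} sat σ (ρ⊆P r∈ρ) grounded
          (λ b b∈r → proj₂ (holds⁺ b b∈r)) (body⁻-true r∈ρ)

        inM×J : TrueHead J σ r → ∃[ h′ ] h′ ∈ head r × pos (inst σ h′) ∈ M × pos (inst σ h′) ∈ J
        inM×J (h′ , h′∈r , h′∈J) = h′ , h′∈r , J⊆M h′∈J , h′∈J

    N-answerSet : IsAnswerSet P N
    N-answerSet = record
      { interpretation = restrict-interpretation {P} (B-mono {P} {π} (proj₁ P-base) (proj₂ P-base)) interpretation
      ; model          = N-model
      ; minimal        = N-minimal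
      }

    N≈⁺M : N ≈⁺ M
    N≈⁺M = (λ a∈ → pos∈⇒∈⁺ {ls = M} (proj₁ (restrict⁻ {P} {M} (∈⁺⇒pos∈ {ls = N} a∈))))
         , (λ a∈ → pos∈⇒∈⁺ {ls = N} (restrict⁺ {P} {M} (∈⁺⇒pos∈ {ls = M} a∈) (M⊆BP (∈⁺⇒pos∈ {ls = M} a∈))))

    -- `N` represents `M` over the base of `P`, so it serves both as the existing answer set and as
    -- the one that any other is compared with.
    M-unique : IsUniqueAnswerSet P M
    M-unique = (N , N-answerSet , N≈⁺M) , λ N′ as′ →
      let N′⊆N , N⊆N′ = answerSet-unique as′ N-answerSet
      in (λ a∈ → proj₁ N≈⁺M (N′⊆N a∈)) , (λ a∈ → N⊆N′ (proj₂ N≈⁺M a∈))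

  -- Projecting the answer set to the remaining program.

  module Splitting (π ρ : Program) (safe : All Safe π) (ρ⊆π : ρ ⊆ π) (comp : Compilable ρ π)
                   (M : LiteralSet) (as : IsAnswerSet π M) where

    open Compilable comp
    open IsAnswerSet as
    open IsInterpretation interpretation

    rest : Program
    rest = π ∖ ρ

    rest⊆π : rest ⊆ π
    rest⊆π = proj₁ ∘ ∈-filter⁻ (λ r → ¬? (r ∈? ρ))

    rest⁺ : ∀ {r} → r ∈ π → r ∉ ρ → r ∈ rest
    rest⁺ = ∈-filter⁺ (λ r → ¬? (r ∈? ρ))

    classify : ∀ {r} → r ∈ π → r ∈ ρ ⊎ r ∈ rest
    classify {r} r∈π = ⊎-map₂ (rest⁺ r∈π) (toSum (r ∈? ρ))

    separated′ : ∀ {r} {a : Atom Term} → r ∈ rest → a ∈ atoms r → pred a ∉ headPreds ρ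
    separated′ r∈rest a∈r a∈ρ = separated a∈ρ (pred∈preds r∈rest a∈r)

    ground-safe : ∀ {Q r} σ → r ∈ π → (∀ b → pos b ∈ body r → B Q (inst σ b)) → Grounded Q σ r
    ground-safe {Q} {r} σ r∈π = safe⇒grounded {Q} {σ} {r} (All.lookup safe r∈π)

    -- By separation the body of a rule in `rest` mentions no head predicate of `ρ`, so the
    -- induction hypothesis places its positive body in the base of `rest`. Safety then keeps
    -- constants that occur only in `ρ` out of the head.
    split : ∀ {a} → pos a ∈ M → pred a ∈ headPreds ρ ⊎ B rest a
    split = minimal⇒⊆ as (λ a → (pred a ∈ⁿ? headPreds ρ) ⊎-dec B? rest a) λ σ r∈π gr holds⁺ _ h h∈r h∈M →
      h , h∈r , h∈M , [ (λ r∈ρ → inj₁ (pred∈headPreds r∈ρ h∈r))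
                      , (λ r∈rest → inj₂ (grounded⇒base {rest} r∈rest
                          (ground-safe {rest} σ r∈π λ b b∈r →
                            [ (λ b∈ρ → ⊥-elim (separated′ r∈rest (body⊆atoms b∈r) b∈ρ)) , id ]′ (proj₂ (holds⁺ b b∈r)))
                          (head⊆atoms h∈r))) ]′ (classify r∈π)

    M′ : LiteralSet
    M′ = restrict rest M

    M′-interpretation : IsInterpretation rest M′
    M′-interpretation = restrict-interpretation {rest} (B-mono {rest} {π} (preds-mono rest⊆π) (U-mono rest⊆π)) interpretation

    rest-head∈M′ : ∀ {r} σ → r ∈ rest → ∀ {h} → h ∈ head r → pos (inst σ h) ∈ M → pos (inst σ h) ∈ M′
    rest-head∈M′ σ r∈rest h∈r h∈M =
      restrict⁺ {rest} {M} h∈M ([ (λ h∈ρ → ⊥-elim (separated′ r∈rest (head⊆atoms h∈r) h∈ρ)) , id ]′ (split h∈M))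

    -- A smaller model `J` is extended by the atoms of `M` over the head predicates of `ρ`. Rules of
    -- `ρ` derive only such atoms, and rules of `rest` cannot see them and so fire inside `J`.
    -- Minimality of `M` makes this union exhaust `M`, and separation excludes the added atoms from
    -- `M′`.
    M′-minimal : ¬ (∃[ J ] IsInterpretation rest J × Satisfies J (Reduct (Ground rest) M′) × J ⁺ ⊊ M′ ⁺)
    M′-minimal (J , int , sat , J⊆ , J⊉) = J⊉ M′⊆J
      where
      J⊆M : ∀ {a} → pos a ∈ J → pos a ∈ M
      J⊆M a∈ = proj₁ (restrict⁻ {rest} {M} (∈⁺⇒pos∈ {ls = M′} (J⊆ (pos∈⇒∈⁺ {ls = J} a∈))))

      step : ∀ {r} σ → r ∈ π → Grounded π σ r →
        (∀ b → pos b ∈ body r → pos (inst σ b) ∈ M × (pred b ∈ headPreds ρ ⊎ pos (inst σ b) ∈ J)) →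
        (∀ b → (∼ b) ∈ body r → (∼ inst σ b) ∈ M) →
        ∀ h → h ∈ head r → pos (inst σ h) ∈ M →
        ∃[ h′ ] h′ ∈ head r × pos (inst σ h′) ∈ M × (pred h′ ∈ headPreds ρ ⊎ pos (inst σ h′) ∈ J)
      step {r} σ r∈π _ holds⁺ holds⁻ h h∈r h∈M =
        [ (λ r∈ρ → h , h∈r , h∈M , inj₁ (pred∈headPreds r∈ρ h∈r))
        , (λ r∈rest → inM×J (fire r∈rest))
        ]′ (classify r∈π)
        where
        body⁺-true : r ∈ rest → ∀ b → pos b ∈ body r → pos (inst σ b) ∈ J
        body⁺-true r∈rest b b∈r =
          [ (λ b∈ρ → ⊥-elim (separated′ r∈rest (body⊆atoms b∈r) b∈ρ)) , id ]′ (proj₂ (holds⁺ b b∈r))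

        grounded : r ∈ rest → Grounded rest σ r
        -- The positive body holds in `J`, an interpretation of `rest`, so its instances already lie
        -- in the required base.
        grounded r∈rest = ground-safe {rest} σ r∈π λ b b∈r →
          IsInterpretation.overBase int (pos (inst σ b)) (body⁺-true r∈rest b b∈r)

        body⁻-true : r ∈ rest → ∀ b → (∼ b) ∈ body r → (∼ inst σ b) ∈ M′
        body⁻-true r∈rest b b∈r =
          restrict⁺ {rest} {M} (holds⁻ b b∈r) (grounded⇒base {rest} r∈rest (grounded r∈rest) (body⊆atoms b∈r))

        fire : r ∈ rest → TrueHead J σ r
        fire r∈rest = applyReduct {rest} {M′} {J} sat σ r∈rest (grounded r∈rest) (body⁺-true r∈rest) (body⁻-true r∈rest)

        inM×J : TrueHead J σ r →
          ∃[ h′ ] h′ ∈ head r × pos (inst σ h′) ∈ M × (pred h′ ∈ headPreds ρ ⊎ pos (inst σ h′) ∈ J)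
        inM×J (h′ , h′∈r , h′∈J) = h′ , h′∈r , J⊆M h′∈J , inj₂ h′∈J

      kept : ∀ {a} → pos a ∈ M → pred a ∈ headPreds ρ ⊎ pos a ∈ J
      kept = minimal⇒⊆ as (λ a → (pred a ∈ⁿ? headPreds ρ) ⊎-dec pos∈? J a) step

      M′⊆J : M′ ⁺ ⊆ J ⁺
      M′⊆J a∈ =
        let a∈M , a∈B = restrict⁻ {rest} {M} (∈⁺⇒pos∈ {ls = M′} a∈)
        in pos∈⇒∈⁺ {ls = J} ([ (λ a∈ρ → ⊥-elim (separated a∈ρ (proj₁ a∈B))) , id ]′ (kept a∈M))

    M′-answerSet : IsAnswerSet rest M′
    M′-answerSet = record
      { interpretation = M′-interpretation
      ; model          = mkModel λ σ r∈rest gr holds →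
          restrict-rule {rest} model (U-mono rest⊆π) σ (rest⊆π r∈rest) r∈rest gr holds
      ; minimal        = M′-minimal
      }

    M-unique : IsUniqueAnswerSet (map fact (M′ ⁺) ++ ρ) M
    M-unique = Recombination.M-unique π ρ safe ρ⊆π stratified as
      (λ a∈ → proj₁ (restrict⁻ {rest} {M} (∈⁺⇒pos∈ {ls = M′} a∈)))
      -- A rule outside `ρ` lies in `rest`, and its true head atoms survive the restriction to `M′`,
      -- so they are among the added facts.
      (λ σ r∈π r∉ρ h∈r h∈M → pos∈⇒∈⁺ (rest-head∈M′ σ (rest⁺ r∈π r∉ρ) h∈r h∈M))

theorem1 : (arity : Predicate → ℕ) → let open ASP arity in
    (π ρ : Program) → All NonEmpty π → All Safe π →
    ρ ⊆ π → Compilable ρ π →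
    (M : LiteralSet) → IsAnswerSet π M →
    ∃[ M′ ] IsAnswerSet (π ∖ ρ) M′ × IsUniqueAnswerSet (map fact (M′ ⁺) ++ ρ) M
theorem1 arity π ρ _ safe ρ⊆π comp M as = M′ , M′-answerSet , M-unique
  where open Answers.Splitting arity π ρ safe ρ⊆π comp M as
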